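{- Let $M$ be a countable $\omega$-categorical homogeneous structure with weak elimination of imaginaries and no algebraicity. Then $$\mathrm{Aut}_{\mathrm{top}}(\mathrm{Aut}(M))\cong \mathrm{Aut}(\mathcal{E}_M),$$ where $\mathcal{E}_M$ is the orbital structure associated with $M$. In particular, if $M$ has in addition the small index property, then $\mathrm{Aut}(\mathrm{Aut}(M))\cong\mathrm{Aut}(\mathcal{E}_M)$.
   Context: A countable structure is $\omega$-categorical if it is, up to isomorphism, the only countable model of its first-order theory. $G=\mathrm{Aut}(M)$ carries the topology whose basic open subgroups are the pointwise stabilizers of finite subsets of $M$; $\mathrm{Aut}_{\mathrm{top}}(G)$ is the group of group automorphisms of $G$ that are homeomorphisms, and $\mathrm{Aut}(G)$ is the group of all group automorphisms. $M$ is homogeneous if every isomorphism between finitely generated substructures extends to an automorphism of $M$. For $A\subseteq M$, $G_{(A)}$ and $G_{\{A\}}$ are the pointwise and setwise stabilizers of $A$. For finite $A$, $a\in M$ is algebraic over $A$ if its $G_{(A)}$-orbit is finite; a finite set is algebraically closed if it contains all elements algebraic over it; $M$ has no algebraicity if every finite subset of $M$ is algebraically closed. $M$ has weak elimination of imaginaries if for every $H\leq G$ containing the pointwise stabilizer of a finite set there is a unique smallest finite algebraically closed $K\subseteq M$ with $G_{(K)}\leq H\leq G_{\{K\}}$. $M$ has the small index property if every subgroup of $G$ of index less than $2^{\aleph_0}$ is open. The orbital structure $\mathcal{E}_M$ has the same domain as $M$ and, for every $0<n<\omega$, a relation $E_n$ of arity $2n$ such that, for $\bar a,\bar b\in M^n$,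 $\bar a E_n\bar b$ iff there is an automorphism of $M$ mapping $\bar a$ to $\bar b$. -}

module Defs where

open import Algebra.Bundles using (Group)
open import Algebra.Morphism.Structures using (IsGroupIsomorphism)
import Algebra.Morphism.Construct.Composition as Comp
import Algebra.Morphism.Construct.Identity as Ident
open import Algebra.Properties.Group using (⁻¹-anti-homo-∙; ⁻¹-involutive)
open import Data.Bool.Base using (Bool)
open import Data.Empty using (⊥)
open import Data.Fin.Base using (Fin)
open import Data.Irrelevant as Irr using (Irrelevant; [_])
open import Data.List.Base using (List)
open import Data.List.Membership.Propositional using (_∈_)
open import Data.Nat.Base using (ℕ; suc; _+_; NonZero)
open import Data.Product.Base using (Σ; ∃; _×_; _,_; proj₁; proj₂)
open import Data.Refinement.Base using (Refinement; value; proof; _,_)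
open import Data.Vec.Base using (Vec; []; _∷_; map; lookup; take; drop)
open import Data.Vec.Properties using (map-id; map-∘; map-cong)
open import Data.Vec.Relation.Unary.All using (All; []; _∷_)
open import Function.Base using (id; _∘_)
open import Function.Bundles using (Inverse; Injection; Equivalence; _↔_; _↣_; _⇔_; mk⇔)
open import Function.Construct.Composition using (_↔-∘_)
open import Function.Construct.Identity using (↔-id)
open import Function.Construct.Symmetry using (↔-sym)
open import Level using (Level; 0ℓ; _⊔_) renaming (suc to lsuc)
open import Relation.Binary.Bundles using (Setoid)
open import Relation.Binary.Definitions using (_Respects_)
open import Relation.Binary.PropositionalEquality
  using (_≡_; refl; sym; trans; cong; subst; _→-setoid_)
import Relation.Binary.Reasoning.Setoid as SetoidReasoning
open import Relation.Nullary.Negation using (¬_)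
open import Relation.Unary using (Pred; _⊆_; _≐_; _⊢_)

------------------------------------------------------------------------
-- First-order structures

record Language : Set₁ where
  field
    Func    : Set
    Rel     : Set
    arFunc  : Func → ℕ
    arRel   : Rel → ℕ

record Structure (L : Language) : Set₁ where
  open Language L
  field
    Carrier : Set
    fun     : (f : Func) → Vec Carrier (arFunc f) → Carrier
    rel     : (r : Rel) → Vec Carrier (arRel r) → Set

open Structure

record Iso {L : Language} (M N : Structure L) : Set where
  open Language L
  field
    bij      : Carrier M ↔ Carrier N
  open Inverse bij public using (to; from; strictlyInverseˡ; strictlyInverseʳ)
  field
    fun-homo : (f : Func) (xs : Vec (Carrier M) (arFunc f)) →
               to (fun M f xs) ≡ fun N f (map to xs)
    rel-homo : (r : Rel) (xs : Vec (Carrier M) (arRel r)) →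
               rel M r xs ⇔ rel N r (map to xs)

-- "Countable" includes finite.
Countable : {L : Language} → Structure L → Set
Countable M = Carrier M ↣ ℕ

------------------------------------------------------------------------
-- First-order logic with equality

data Term (L : Language) (n : ℕ) : Set where
  var : Fin n → Term L n
  app : (f : Language.Func L) → Vec (Term L n) (Language.arFunc L f) → Term L n

infix  6 _≐'_
infixr 5 _⇒'_

-- The index is the number of free variables.  The other connectives and ∃
-- are classically definable from these.
data Formula (L : Language) : ℕ → Set where
  ⊥'   : ∀ {n} → Formula L n
  _≐'_ : ∀ {n} → Term L n → Term L n → Formula L n
  rel' : ∀ {n} (r : Language.Rel L) → Vec (Term L n) (Language.arRel L r) → Formula L n
  _⇒'_ : ∀ {n} → Formula L n → Formula L n → Formula L n
  ∀'   : ∀ {n} → Formula L (suc n) → Formula L n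

module _ {L : Language} (M : Structure L) where

  eval  : ∀ {n} → Vec (Carrier M) n → Term L n → Carrier M
  evals : ∀ {n k} → Vec (Carrier M) n → Vec (Term L n) k → Vec (Carrier M) k
  eval ρ (var i)    = lookup ρ i
  eval ρ (app f ts) = fun M f (evals ρ ts)
  evals ρ []        = []
  evals ρ (t ∷ ts)  = eval ρ t ∷ evals ρ ts

  Sat : ∀ {n} → Vec (Carrier M) n → Formula L n → Set
  Sat ρ ⊥'         = ⊥
  Sat ρ (s ≐' t)   = eval ρ s ≡ eval ρ t
  Sat ρ (rel' r ts) = rel M r (evals ρ ts)
  Sat ρ (φ ⇒' ψ)   = Sat ρ φ → Sat ρ ψ
  Sat ρ (∀' φ)     = (x : Carrier M) → Sat (x ∷ ρ) φ

Sentence : Language → Set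
Sentence L = Formula L 0

infix 4 _⊨_ _⊨Th_

_⊨_ : {L : Language} → Structure L → Sentence L → Set
M ⊨ φ = Sat M [] φ

_⊨Th_ : {L : Language} → Structure L → Structure L → Set
N ⊨Th M = ∀ φ → M ⊨ φ → N ⊨ φ

ωCategorical : {L : Language} → Structure L → Set₁
ωCategorical {L} M = (N : Structure L) → Countable N → N ⊨Th M → Iso M N

------------------------------------------------------------------------
-- Abstract groups

infix 4 _≅ᴳ_

_≅ᴳ_ : ∀ {a ℓ₁ b ℓ₂} → Group a ℓ₁ → Group b ℓ₂ → Set (a ⊔ ℓ₁ ⊔ b ⊔ ℓ₂)
G ≅ᴳ H = ∃ (IsGroupIsomorphism (Group.rawGroup G) (Group.rawGroup H))

module _ {a ℓ} (G : Group a ℓ) where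
  private
    module G = Group G
    R = G.rawGroup

  apply unapply : G ≅ᴳ G → G.Carrier → G.Carrier
  apply α       = proj₁ α
  unapply α y   = proj₁ (IsGroupIsomorphism.surjective (proj₂ α) y)

  apply-unapply : ∀ α y → apply α (unapply α y) G.≈ y
  apply-unapply α y = proj₂ (IsGroupIsomorphism.surjective (proj₂ α) y) G.refl

  unapply-apply : ∀ α x → unapply α (apply α x) G.≈ x
  unapply-apply α x = IsGroupIsomorphism.injective (proj₂ α) (apply-unapply α (apply α x))

  idᴳ : G ≅ᴳ G
  idᴳ = id , Ident.isGroupIsomorphism R G.refl

  _∘ᴳ_ : G ≅ᴳ G → G ≅ᴳ G → G ≅ᴳ G
  (f , f-iso) ∘ᴳ (g , g-iso) = f ∘ g , Comp.isGroupIsomorphism G.trans g-iso f-iso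

  invᴳ : G ≅ᴳ G → G ≅ᴳ G
  invᴳ α@(f , f-iso) = unapply α , record
    { isGroupMonomorphism = record
      { isGroupHomomorphism = record
        { isMonoidHomomorphism = record
          { isMagmaHomomorphism = record
            { isRelHomomorphism = record
              { cong = λ {x} {y} x≈y → F.injective
                  (G.trans (ap x) (G.trans x≈y (G.sym (ap y)))) }
            ; homo = λ x y → F.injective
                (G.trans (ap (x G.∙ y))
                  (G.sym (G.trans (F.∙-homo _ _) (G.∙-cong (ap x) (ap y)))))
            }
          ; ε-homo = F.injective (G.trans (ap G.ε) (G.sym F.ε-homo))
          }
        ; ⁻¹-homo = λ x → F.injective
            (G.trans (ap (x G.⁻¹))
              (G.sym (G.trans (F.⁻¹-homo _) (G.⁻¹-cong (ap x)))))
        }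
      ; injective = λ {x} {y} e →
          G.trans (G.sym (ap x)) (G.trans (F.⟦⟧-cong e) (ap y))
      }
    ; surjective = λ x → f x , λ e → F.injective (G.trans (ap _) e)
    }
    where
    module F = IsGroupIsomorphism f-iso
    ap = apply-unapply α

  AutGroup : Group (a ⊔ ℓ) (a ⊔ ℓ)
  AutGroup = record
    { Carrier = G ≅ᴳ G
    ; _≈_     = λ α β → ∀ x → apply α x G.≈ apply β x
    ; _∙_     = _∘ᴳ_
    ; ε       = idᴳ
    ; _⁻¹     = invᴳ
    ; isGroup = record
      { isMonoid = record
        { isSemigroup = record
          { isMagma = record
            { isEquivalence = record
              { refl  = λ x → G.refl
              ; sym   = λ e x → G.sym (e x)
              ; trans = λ e e′ x → G.trans (e x) (e′ x)
              }
            ; ∙-cong = λ {α} {β} {γ} {δ} α≈β γ≈δ x →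
                G.trans (IsGroupIsomorphism.⟦⟧-cong (proj₂ α) (γ≈δ x)) (α≈β (apply δ x))
            }
          ; assoc = λ α β γ x → G.refl
          }
        ; identity = (λ α x → G.refl) , (λ α x → G.refl)
        }
      ; inverse = unapply-apply , apply-unapply
      ; ⁻¹-cong = λ {α} {β} α≈β x →
          IsGroupIsomorphism.injective (proj₂ α)
            (G.trans (apply-unapply α x)
              (G.trans (G.sym (apply-unapply β x)) (G.sym (α≈β (unapply β x)))))
      }
    }

  record Subgroup (p : Level) : Set (a ⊔ ℓ ⊔ lsuc p) where
    field
      Member    : Pred G.Carrier p
      resp      : Member Respects G._≈_
      ε-closed  : Member G.ε
      ∙-closed  : ∀ {x y} → Member x → Member y → Member (x G.∙ y)
      ⁻¹-closed : ∀ {x} → Member x → Member (x G.⁻¹)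

  Cosets : ∀ {p} → Subgroup p → Setoid a p
  Cosets H = record
    { Carrier = G.Carrier
    ; _≈_     = λ x y → Member (x G.⁻¹ G.∙ y)
    ; isEquivalence = record
      { refl  = λ {x} → resp (G.sym (G.inverseˡ x)) ε-closed
      ; sym   = λ {x} {y} h → resp
          (G.trans (⁻¹-anti-homo-∙ G (x G.⁻¹) y)
                   (G.∙-congˡ (⁻¹-involutive G x)))
          (⁻¹-closed h)
      ; trans = λ {x} {y} {z} h k → resp
          (begin
            (x G.⁻¹ G.∙ y) G.∙ (y G.⁻¹ G.∙ z)  ≈⟨ G.assoc _ _ _ ⟩
            x G.⁻¹ G.∙ (y G.∙ (y G.⁻¹ G.∙ z))  ≈⟨ G.∙-congˡ (G.assoc _ _ _) ⟨
            x G.⁻¹ G.∙ ((y G.∙ y G.⁻¹) G.∙ z)  ≈⟨ G.∙-congˡ (G.∙-congʳ (G.inverseʳ y)) ⟩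
            x G.⁻¹ G.∙ (G.ε G.∙ z)             ≈⟨ G.∙-congˡ (G.identityˡ z) ⟩
            x G.⁻¹ G.∙ z                       ∎)
          (∙-closed h k)
      }
    }
    where
    open Subgroup H
    open SetoidReasoning G.setoid

-- Strict inequality of cardinals: the index is at most 2^ℵ₀ but not at least 2^ℵ₀.
-- The set 2^ℕ carries pointwise equality.
Index<2^ℵ₀ : ∀ {a ℓ p} {G : Group a ℓ} → Subgroup G p → Set (a ⊔ p)
Index<2^ℵ₀ {G = G} H =
  Injection (Cosets G H) (ℕ →-setoid Bool) × ¬ Injection (ℕ →-setoid Bool) (Cosets G H)

------------------------------------------------------------------------
-- The automorphism group of a structure

module _ {L : Language} (M : Structure L) where

  private
    C = Carrier M

    idᴵ : Iso M M
    idᴵ = record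
      { bij      = ↔-id C
      ; fun-homo = λ f xs → cong (fun M f) (sym (map-id xs))
      ; rel-homo = λ r xs → mk⇔ (subst (rel M r) (sym (map-id xs)))
                                (subst (rel M r) (map-id xs))
      }

    _∘ᴵ_ : Iso M M → Iso M M → Iso M M
    g ∘ᴵ h = record
      { bij      = G.bij ↔-∘ H.bij
      ; fun-homo = λ f xs → trans (cong G.to (H.fun-homo f xs))
                     (trans (G.fun-homo f (map H.to xs))
                       (cong (fun M f) (sym (map-∘ G.to H.to xs))))
      ; rel-homo = λ r xs → mk⇔
          (subst (rel M r) (sym (map-∘ G.to H.to xs))
            ∘ Equivalence.to (G.rel-homo r (map H.to xs))
            ∘ Equivalence.to (H.rel-homo r xs))
          (Equivalence.from (H.rel-homo r xs)
            ∘ Equivalence.from (G.rel-homo r (map H.to xs))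
            ∘ subst (rel M r) (map-∘ G.to H.to xs))
      }
      where
      module G = Iso g
      module H = Iso h

    invᴵ : Iso M M → Iso M M
    invᴵ g = record
      { bij      = ↔-sym G.bij
      ; fun-homo = λ f xs → trans
          (cong (G.from ∘ fun M f) (sym (to∘from xs)))
          (trans (cong G.from (sym (G.fun-homo f (map G.from xs))))
            (G.strictlyInverseʳ _))
      ; rel-homo = λ r xs → mk⇔
          (Equivalence.from (G.rel-homo r (map G.from xs))
            ∘ subst (rel M r) (sym (to∘from xs)))
          (subst (rel M r) (to∘from xs)
            ∘ Equivalence.to (G.rel-homo r (map G.from xs)))
      }
      where
      module G = Iso g
      to∘from : ∀ {k} (xs : Vec C k) → map G.to (map G.from xs) ≡ xs
      to∘from xs = trans (sym (map-∘ G.to G.from xs))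
                     (trans (map-cong G.strictlyInverseˡ xs) (map-id xs))

  Aut : Group 0ℓ 0ℓ
  Aut = record
    { Carrier = Iso M M
    ; _≈_     = λ g h → ∀ x → Iso.to g x ≡ Iso.to h x
    ; _∙_     = _∘ᴵ_
    ; ε       = idᴵ
    ; _⁻¹     = invᴵ
    ; isGroup = record
      { isMonoid = record
        { isSemigroup = record
          { isMagma = record
            { isEquivalence = record
              { refl  = λ x → refl
              ; sym   = λ e x → sym (e x)
              ; trans = λ e e′ x → trans (e x) (e′ x)
              }
            ; ∙-cong = λ {g} {g′} {h} {h′} g≈g′ h≈h′ x →
                trans (cong (Iso.to g) (h≈h′ x)) (g≈g′ (Iso.to h′ x))
            }
          ; assoc = λ g h k x → refl
          }
        ; identity = (λ g x → refl) , (λ g x → refl)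
        }
      ; inverse = Iso.strictlyInverseʳ , Iso.strictlyInverseˡ
      ; ⁻¹-cong = λ {g} {h} g≈h x →
          trans (cong (Iso.from g) (sym (Iso.strictlyInverseˡ h x)))
            (trans (cong (Iso.from g) (sym (g≈h (Iso.from h x))))
              (Iso.strictlyInverseʳ g (Iso.from h x)))
      }
    }

  -- Finite subsets of M are given by lists, which matter only up to having
  -- the same members.

  PointwiseStabilizer SetwiseStabilizer : List C → Pred (Iso M M) 0ℓ
  PointwiseStabilizer A g = ∀ {x} → x ∈ A → Iso.to g x ≡ x
  SetwiseStabilizer   A g = ∀ x → x ∈ A ⇔ Iso.to g x ∈ A

  Orbit : List C → C → Pred C 0ℓ
  Orbit A a x = ∃ λ g → PointwiseStabilizer A g × Iso.to g a ≡ x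

  Finite : Pred C 0ℓ → Set
  Finite P = ∃ λ xs → P ≐ (_∈ xs)

  Algebraic : List C → Pred C 0ℓ
  Algebraic A a = Finite (Orbit A a)

  AlgebraicallyClosed : List C → Set
  AlgebraicallyClosed A = ∀ {a} → Algebraic A a → a ∈ A

  NoAlgebraicity : Set
  NoAlgebraicity = ∀ A → AlgebraicallyClosed A

  Supports : Subgroup Aut 0ℓ → List C → Set
  Supports H K = AlgebraicallyClosed K
               × PointwiseStabilizer K ⊆ Subgroup.Member H
               × Subgroup.Member H ⊆ SetwiseStabilizer K

  -- Being least under inclusion makes K unique as a set of elements.
  WeakEliminationOfImaginaries : Set₁
  WeakEliminationOfImaginaries =
    (H : Subgroup Aut 0ℓ) →
    (∃ λ A → PointwiseStabilizer A ⊆ Subgroup.Member H) →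
    ∃ λ K → Supports H K × (∀ K′ → Supports H K′ → (_∈ K) ⊆ (_∈ K′))

  -- U contains, with each element g, a basic coset g G₍A₎.
  -- The subset U respects the equality of Aut as a consequence.
  Open : Pred (Iso M M) 0ℓ → Set
  Open U = ∀ {g} → U g →
    ∃ λ A → ∀ h → PointwiseStabilizer A (g ⁻¹ ∙ h) → U h
    where open Group Aut

  Continuous : (Iso M M → Iso M M) → Set₁
  Continuous f = ∀ U → Open U → Open (f ⊢ U)

  record TopAut : Set₁ where
    field
      aut        : Aut ≅ᴳ Aut
      to-cont    : Continuous (apply Aut aut)
      from-cont  : Continuous (unapply Aut aut)

  open TopAut

  AutTop : Group (lsuc 0ℓ) 0ℓ
  AutTop = record
    { Carrier = TopAut
    ; _≈_     = λ α β → aut α A.≈ aut β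
    ; _∙_     = λ α β → record
        { aut       = aut α A.∙ aut β
        ; to-cont   = λ U → to-cont β _ ∘ to-cont α U
        ; from-cont = λ U → from-cont α _ ∘ from-cont β U
        }
    ; ε       = record { aut = A.ε ; to-cont = λ U → id ; from-cont = λ U → id }
    ; _⁻¹     = λ α → record
        { aut = aut α A.⁻¹ ; to-cont = from-cont α ; from-cont = to-cont α }
    ; isGroup = record
      { isMonoid = record
        { isSemigroup = record
          { isMagma = record
            { isEquivalence = record
              { refl  = λ {α} → A.refl {aut α}
              ; sym   = λ {α β} → A.sym {aut α} {aut β}
              ; trans = λ {α β γ} → A.trans {aut α} {aut β} {aut γ}
              }
            ; ∙-cong = λ {α β γ δ} → A.∙-cong {aut α} {aut β} {aut γ} {aut δ}
            }
          ; assoc = λ α β γ → A.assoc (aut α) (aut β) (aut γ)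
          }
        ; identity = (λ α → A.identityˡ (aut α)) , (λ α → A.identityʳ (aut α))
        }
      ; inverse = (λ α → A.inverseˡ (aut α)) , (λ α → A.inverseʳ (aut α))
      ; ⁻¹-cong = λ {α β} → A.⁻¹-cong {aut α} {aut β}
      }
    }
    where module A = Group (AutGroup Aut)

  SmallIndexProperty : Set₁
  SmallIndexProperty =
    (H : Subgroup Aut 0ℓ) → Index<2^ℵ₀ H → Open (Subgroup.Member H)

------------------------------------------------------------------------
-- Homogeneity

module _ {L : Language} (M : Structure L) where
  open Language L

  data Generated (A : List (Carrier M)) : Pred (Carrier M) 0ℓ where
    gen : ∀ {x} → x ∈ A → Generated A x
    app : ∀ f {xs} → All (Generated A) xs → Generated A (fun M f xs)

  private
    gather : ∀ {A k} (xs : Vec (Refinement (Carrier M) (Generated A)) k) →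
             Irrelevant (All (Generated A) (map value xs))
    gather []       = [ [] ]
    gather (x ∷ xs) = Irr.zipWith _∷_ (proof x) (gather xs)

  -- Membership proofs are irrelevant, so that equality of elements of the
  -- substructure is equality in M.
  ⟨_⟩ : List (Carrier M) → Structure L
  ⟨ A ⟩ = record
    { Carrier = Refinement (Carrier M) (Generated A)
    ; fun     = λ f xs → fun M f (map value xs) , Irr.map (app f) (gather xs)
    ; rel     = λ r xs → rel M r (map value xs)
    }

  Homogeneous : Set
  Homogeneous = ∀ A B (i : Iso ⟨ A ⟩ ⟨ B ⟩) →
    ∃ λ (g : Iso M M) → ∀ x → Iso.to g (value x) ≡ value (Iso.to i x)

------------------------------------------------------------------------
-- The orbital structure

OrbitalLanguage : Language
OrbitalLanguage = record
  { Func   = ⊥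
  ; Rel    = Σ ℕ NonZero
  ; arFunc = λ ()
  ; arRel  = λ (n , _) → n + n
  }

-- A vector of length n + n is read as the concatenation of two n-tuples.
𝓔 : {L : Language} → Structure L → Structure OrbitalLanguage
𝓔 M = record
  { Carrier = Carrier M
  ; fun     = λ ()
  ; rel     = λ (n , _) v → ∃ λ (g : Iso M M) → map (Iso.to g) (take n v) ≡ drop n v
  }

{-# OPTIONS --safe #-}
module Submission where

-- Let α be a topological automorphism of G = Aut(M).  By weak elimination of
-- imaginaries, α(G₍K₎) lies between G₍K'₎ and G_{K'} for a finite K', and
-- α⁻¹(G₍K'₎) lies between G₍K''₎ and G_{K''}.  As α⁻¹(G₍K'₎) has finite index
-- in G₍K₎, every point of K'' is algebraic over K, so K'' ⊆ K; this forces
-- α(G₍K₎) = G₍K'₎.  Applied to α and α⁻¹, this shows that α permutes the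
-- stabilizers of points, since these are maximal among the proper subgroups
-- of the form G₍K₎.  The resulting permutation σ of M satisfies
-- α(g) = σ g σ⁻¹, hence preserves the orbits of G on tuples.  Conversely,
-- conjugation by a permutation preserving these orbits maps G to G, because
-- G is closed in Sym(M).
-- If M has the small index property, every automorphism α of G is
-- continuous: α⁻¹(G₍A₎) has countable index, which is below 2^ℵ₀ by Cantor's
-- theorem.

open import Defs
open import Algebra.Bundles using (Group)
open import Algebra.Morphism.Structures using (IsGroupIsomorphism)
import Algebra.Morphism.Construct.Composition as Comp
open import Axiom.ExcludedMiddle using (ExcludedMiddle)
open import Data.Bool.Base using (Bool; false; T)
open import Data.List.Base as List using (List; []; _∷_)
open import Data.List.Membership.Propositional using (_∈_; lose)
open import Data.List.Membership.Propositional.Properties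
  using (∈-map⁺; ∈-concatMap⁺; ∈-cartesianProductWith⁺; ∈-filter⁺; ∈-filter⁻)
open import Data.List.Properties using (∷-injective; map-cong-local)
open import Data.List.Relation.Unary.All using (tabulate)
open import Data.List.Relation.Unary.Any using (here; there)
open import Data.Nat.Base using (ℕ; zero; suc; _+_; _*_; _≡ᵇ_; _<_)
open import Data.Nat.Properties
  using (+-cancelˡ-≡; <-cmp; <⇒≢; +-monoʳ-≤; *-mono-≤; m≤m+n; ≡ᵇ⇒≡; ≡⇒≡ᵇ;
         module ≤-Reasoning)
open import Data.Nat.Solver using (module +-*-Solver)
open import Data.Product.Base using (∃; _×_; _,_; proj₁; proj₂)
open import Data.Vec.Base as Vec using (Vec; []; _∷_; _++_; take; drop)
open import Data.Vec.Properties
  using (map-∘; map-cong; map-id; take-map; drop-map; take++drop≡id; ++-injective;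
         ∷-injectiveˡ; ∷-injectiveʳ)
open import Function.Base using (_∘_; id)
open import Function.Bundles
  using (Inverse; Injection; Equivalence; _↔_; _⇔_; mk⇔; mk↔ₛ′)
open import Function.Construct.Composition using (_↔-∘_)
open import Function.Construct.Symmetry using (↔-sym)
open import Function.Properties.Inverse using (↔⇒↣)
open import Level using (0ℓ)
open import Relation.Binary.Definitions using (tri<; tri≈; tri>)
open import Relation.Binary.PropositionalEquality
  using (_≡_; refl; sym; trans; cong; cong₂; subst; setoid; _→-setoid_;
         module ≡-Reasoning)
open import Relation.Nullary.Decidable using (Dec; yes; no; does)
open import Relation.Nullary.Negation using (¬_; contradiction)
open import Relation.Unary using (_⊆_; _⊢_)

open Structure using (Carrier; fun; rel)
open Iso using (to; from; strictlyInverseˡ; strictlyInverseʳ)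
open TopAut using (aut; to-cont; from-cont)

-- Injectivity of bijections and of mapped vectors.

↔-injective : ∀ {a b} {A : Set a} {B : Set b} (f : A ↔ B) {x y : A} →
              Inverse.to f x ≡ Inverse.to f y → x ≡ y
↔-injective f = Injection.injective (↔⇒↣ f)

Vec-map-injective : ∀ {a b n} {A : Set a} {B : Set b} {f : A → B} {xs ys : Vec A n} →
  (∀ {x y} → f x ≡ f y → x ≡ y) → Vec.map f xs ≡ Vec.map f ys → xs ≡ ys
Vec-map-injective {xs = []}     {[]}     inj eq = refl
Vec-map-injective {xs = x ∷ xs} {y ∷ ys} inj eq =
  cong₂ _∷_ (inj (∷-injectiveˡ eq)) (Vec-map-injective inj (∷-injectiveʳ eq))

-- Countable index is small

-- A Cantor pairing with the square of s = x + y in place of a triangular number: the diagonal s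
-- takes values from s² to s² + s, all below (s + 1)².
pair : ℕ → ℕ → ℕ
pair x y = (x + y) * (x + y) + x

pair-<-diagonal : ∀ x y x′ y′ → x + y < x′ + y′ → pair x y < pair x′ y′
pair-<-diagonal x y x′ y′ s<s′ = begin-strict
  (x + y) * (x + y) + x                  ≤⟨ +-monoʳ-≤ _ (m≤m+n x y) ⟩
  (x + y) * (x + y) + (x + y)            <⟨ m≤m+n _ (x + y) ⟩
  suc ((x + y) * (x + y) + (x + y)) + (x + y)
    ≡⟨ solve 1 (λ s → con 1 :+ (s :* s :+ s) :+ s := (con 1 :+ s) :* (con 1 :+ s)) refl (x + y) ⟩
  suc (x + y) * suc (x + y)              ≤⟨ *-mono-≤ s<s′ s<s′ ⟩
  (x′ + y′) * (x′ + y′)                  ≤⟨ m≤m+n _ x′ ⟩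
  (x′ + y′) * (x′ + y′) + x′             ∎
  where
  open ≤-Reasoning
  open +-*-Solver

pair-injective : ∀ x y x′ y′ → pair x y ≡ pair x′ y′ → x ≡ x′ × y ≡ y′
pair-injective x y x′ y′ eq with <-cmp (x + y) (x′ + y′)
... | tri< s<s′ _ _ = contradiction eq (<⇒≢ (pair-<-diagonal x y x′ y′ s<s′))
... | tri> _ _ s>s′ = contradiction (sym eq) (<⇒≢ (pair-<-diagonal x′ y′ x y s>s′))
... | tri≈ _ s≡s′ _ = x≡x′ , +-cancelˡ-≡ x y y′
                        (trans s≡s′ (cong (_+ y′) (sym x≡x′)))
  where
  x≡x′ = +-cancelˡ-≡ ((x + y) * (x + y)) x x′
           (trans eq (cong (λ s → s * s + x′) (sym s≡s′)))

-- Injective only among lists of a fixed length: pair 0 0 = 0.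
code : List ℕ → ℕ
code = List.foldr pair 0

module _ {a} {A : Set a} where

  map-cong-∈ : ∀ {b} {B : Set b} {f g : A → B} xs →
               (∀ {x} → x ∈ xs → f x ≡ g x) → List.map f xs ≡ List.map g xs
  map-cong-∈ xs f≗g = map-cong-local (tabulate f≗g)

  map-cong-∈⁻ : ∀ {b} {B : Set b} {f g : A → B} xs →
                List.map f xs ≡ List.map g xs → ∀ {x} → x ∈ xs → f x ≡ g x
  map-cong-∈⁻ (x ∷ xs) eq (here refl) = proj₁ (∷-injective eq)
  map-cong-∈⁻ (x ∷ xs) eq (there x∈xs) = map-cong-∈⁻ xs (proj₂ (∷-injective eq)) x∈xs

  code-map-injective : ∀ {f g : A → ℕ} xs →
    code (List.map f xs) ≡ code (List.map g xs) → List.map f xs ≡ List.map g xs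
  code-map-injective []       eq = refl
  code-map-injective (x ∷ xs) eq =
    let fx≡gx , eq′ = pair-injective _ _ _ _ eq
    in cong₂ _∷_ fx≡gx (code-map-injective xs eq′)

-- Cantor's diagonal argument without a partial inverse of the injection: `d n` is true exactly when
-- some sequence with image n is false at n.
¬2^ℕ↣ℕ : ExcludedMiddle 0ℓ → ¬ Injection (ℕ →-setoid Bool) (setoid ℕ)
¬2^ℕ↣ℕ em F = diagonal em refl
  where
  F′ = Injection.to F

  Q : ℕ → Set
  Q n = ∃ λ f → F′ f ≡ n × f n ≡ false

  d : ℕ → Bool
  d n = does (em {Q n})

  -- The decision is a variable tied to `d` by an equation, so that splitting on it leaves the `d`
  -- inside `F′ d` alone.
  diagonal : (q : Dec (Q (F′ d))) → ¬ (does q ≡ d (F′ d))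
  diagonal (yes (f , Ff≡Fd , fn≡false)) eq =
    contradiction (trans eq (trans (sym (Injection.injective F Ff≡Fd _)) fn≡false)) λ ()
  diagonal (no ¬q) eq = ¬q (d , refl , sym eq)

Index<2^ℵ₀-countable : ∀ {a ℓ p} {G : Group a ℓ} → ExcludedMiddle 0ℓ →
  (H : Subgroup G p) → Injection (Cosets G H) (setoid ℕ) → Index<2^ℵ₀ H
Index<2^ℵ₀-countable em H c = record
  -- A coset goes to the indicator of the singleton of its code; comparing two indicators at `to′ x`
  -- recovers the equality of codes.
  { to        = λ x n → to′ x ≡ᵇ n
  ; cong      = λ {x} {y} x≈y n → cong (_≡ᵇ n) (cong′ x≈y)
  ; injective = λ {x} {y} e → injective (sym (≡ᵇ⇒≡ _ _
      (subst T (e (to′ x)) (≡⇒≡ᵇ (to′ x) _ refl))))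
  } , λ i → ¬2^ℕ↣ℕ em record
  { to        = to′ ∘ Injection.to i
  ; cong      = λ e → cong′ (Injection.cong i e)
  ; injective = λ e → Injection.injective i (injective e)
  }
  where
  open Injection c renaming (to to to′; cong to cong′)

-- Tuples over a finite set.

module _ {a} {A : Set a} where

  tuples : List A → ℕ → List (List A)
  tuples xs zero    = [] ∷ []
  tuples xs (suc n) = List.cartesianProductWith _∷_ xs (tuples xs n)

  map-∈-tuples : ∀ {b} {B : Set b} {f : B → A} {xs} ys →
    (∀ {y} → y ∈ ys → f y ∈ xs) → List.map f ys ∈ tuples xs (List.length ys)
  map-∈-tuples []       f∈ = here refl
  map-∈-tuples (y ∷ ys) f∈ =
    ∈-cartesianProductWith⁺ _∷_ (f∈ (here refl)) (map-∈-tuples ys (f∈ ∘ there))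

-- Composition of group isomorphisms, preimages of subgroups.

≅ᴳ-trans : ∀ {a₁ ℓ₁ a₂ ℓ₂ a₃ ℓ₃}
  {G : Group a₁ ℓ₁} {H : Group a₂ ℓ₂} {K : Group a₃ ℓ₃} → G ≅ᴳ H → H ≅ᴳ K → G ≅ᴳ K
≅ᴳ-trans {K = K} (f , f-iso) (g , g-iso) =
  g ∘ f , Comp.isGroupIsomorphism (Group.trans K) f-iso g-iso

preimage : ∀ {a ℓ p} {G : Group a ℓ} → G ≅ᴳ G → Subgroup G p → Subgroup G p
preimage {G = G} α H = record
  { Member    = apply G α ⊢ Member
  ; resp      = λ x≈y → resp (A.⟦⟧-cong x≈y)
  ; ε-closed  = resp (G.sym A.ε-homo) ε-closed
  ; ∙-closed  = λ p q → resp (G.sym (A.∙-homo _ _)) (∙-closed p q)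
  ; ⁻¹-closed = λ p → resp (G.sym (A.⁻¹-homo _)) (⁻¹-closed p)
  }
  where
  open Subgroup H
  module G = Group G
  module A = IsGroupIsomorphism (proj₂ α)

module _ {L : Language} (M : Structure L) where

  private
    C = Carrier M
    module G = Group (Aut M)
    module T = Group (AutTop M)
    module E = Group (Aut (𝓔 M))

    Stab = PointwiseStabilizer M

  -- Pointwise stabilizers as subgroups.

  stabilizer : List C → Subgroup (Aut M) 0ℓ
  stabilizer A = record
    { Member    = Stab A
    ; resp      = λ g≈h gA x∈A → trans (sym (g≈h _)) (gA x∈A)
    ; ε-closed  = λ _ → refl
    ; ∙-closed  = λ {g} gA hA x∈A → trans (cong (to g) (hA x∈A)) (gA x∈A)
    ; ⁻¹-closed = λ {g} gA x∈A →
        trans (cong (from g) (sym (gA x∈A))) (strictlyInverseʳ g _)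
    }

  -- Continuity

  stabilizer-open : ∀ A → Open M (Stab A)
  stabilizer-open A {g} gA = A , λ h g⁻¹hA x∈A →
    trans (sym (strictlyInverseˡ g (to h _)))
      (trans (cong (to g) (g⁻¹hA x∈A)) (gA x∈A))

  ContinuousAt-ε : Aut M ≅ᴳ Aut M → Set
  ContinuousAt-ε α = ∀ A → ∃ λ B → Stab B ⊆ (apply (Aut M) α ⊢ Stab A)

  continuous⇒continuousAt-ε : ∀ α → Continuous M (apply (Aut M) α) → ContinuousAt-ε α
  continuous⇒continuousAt-ε α α-cont A =
    let B , p = α-cont (Stab A) (λ {g} → stabilizer-open A {g}) {G.ε}
                  (Subgroup.ε-closed (preimage α (stabilizer A)))
    in B , λ {h} → p h

  -- Translation: α(g⁻¹h) = α(g)⁻¹α(h) carries the condition at the identity to g.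
  continuousAt-ε⇒continuous : ∀ α → ContinuousAt-ε α → Continuous M (apply (Aut M) α)
  continuousAt-ε⇒continuous α α-cont U U-open {g} Uαg =
    let A , p = U-open Uαg
        B , q = α-cont A
    in B , λ h g⁻¹hB → p (apply (Aut M) α h)
         (Subgroup.resp (stabilizer A) {apply (Aut M) α (g G.⁻¹ G.∙ h)}
           {apply (Aut M) α g G.⁻¹ G.∙ apply (Aut M) α h}
           (λ x → trans (α.∙-homo (g G.⁻¹) h x) (α.⁻¹-homo g (to (apply (Aut M) α h) x)))
           (q {g G.⁻¹ G.∙ h} g⁻¹hB))
    where module α = IsGroupIsomorphism (proj₂ α)

  -- Elements g and h lie in the same left coset iff α(g) and α(h) agree on A, so the tuple α(g)(A),
  -- coded as a number, determines the coset.
  preimage-stabilizer-index : ExcludedMiddle 0ℓ → Countable M →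
    ∀ α A → Index<2^ℵ₀ (preimage α (stabilizer A))
  preimage-stabilizer-index em ι α A = Index<2^ℵ₀-countable em (preimage α (stabilizer A)) record
    { to        = λ g → code (List.map (Injection.to ι ∘ to (f g)) A)
    ; cong      = λ {g} {h} g≈h → cong code (map-cong-∈ A λ {x} x∈A →
        cong (Injection.to ι)
          (trans (cong (to (f g)) (trans (sym (g≈h x∈A)) (f-⁻¹∙ g h x)))
            (strictlyInverseˡ (f g) _)))
    ; injective = λ {g} {h} eq {x} x∈A → trans (f-⁻¹∙ g h x)
        (trans (cong (from (f g)) (sym (Injection.injective ι
          (map-cong-∈⁻ A (code-map-injective A eq) x∈A))))
          (strictlyInverseʳ (f g) x))
    }
    where
    module α = IsGroupIsomorphism (proj₂ α)
    f = apply (Aut M) α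
    f-⁻¹∙ : ∀ g h x → to (f (g G.⁻¹ G.∙ h)) x ≡ from (f g) (to (f h) x)
    f-⁻¹∙ g h x = trans (α.∙-homo (g G.⁻¹) h x) (α.⁻¹-homo g (to (f h) x))

  smallIndex⇒continuous : ExcludedMiddle 0ℓ → Countable M → SmallIndexProperty M →
    ∀ α → Continuous M (apply (Aut M) α)
  smallIndex⇒continuous em ι sip α = continuousAt-ε⇒continuous α λ A →
    let H = preimage α (stabilizer A)
        B , p = sip H (preimage-stabilizer-index em ι α A) {G.ε} (Subgroup.ε-closed H)
    in B , λ {h} → p h

  -- The stabilizers G₍K₎ under an automorphism of G

  -- The orbit of y over A is the singleton of y, so y is algebraic over A.
  fixed⇒∈ : NoAlgebraicity M → ∀ {A y} →
            (∀ h → Stab A h → to h y ≡ y) → y ∈ A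
  fixed⇒∈ na {A} {y} fix = na A
    ( y ∷ []
    , (λ { (h , hA , refl) → here (fix h hA) })
    , (λ { (here refl) → G.ε , (λ _ → refl) , refl }))

  -- A point is determined by its stabilizer; equalities between points are proved below by
  -- comparing stabilizers.
  fixes-fixed⇒≡ : NoAlgebraicity M → ∀ {x y} →
                  (∀ h → to h x ≡ x → to h y ≡ y) → y ≡ x
  fixes-fixed⇒≡ na {x} fix
    with here y≡x ← fixed⇒∈ na {x ∷ []} (λ h hx → fix h (hx (here refl))) = y≡x

  -- `Finite` asks for an exact enumeration, so the cover is filtered by a classical decision.
  cover⇒finite : ExcludedMiddle 0ℓ → ∀ {P : C → Set} xs → P ⊆ (_∈ xs) → Finite M P
  cover⇒finite em {P} xs P⊆xs = List.filter P? xs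
    , (λ p → ∈-filter⁺ P? (P⊆xs p) p)
    , (λ x∈ → proj₂ (∈-filter⁻ P? {xs = xs} x∈))
    where
    P? : ∀ x → Dec (P x)
    P? x = em

  -- G₍K₎ meets only finitely many left cosets of α⁻¹(G₍K′₎), one for each
  -- tuple that α(g) can make of the enumeration K′.
  setwise⇒algebraic : ExcludedMiddle 0ℓ → ∀ α {K K′ K″} →
    Stab K ⊆ (apply (Aut M) α ⊢ SetwiseStabilizer M K′) →
    (apply (Aut M) α ⊢ Stab K′) ⊆ SetwiseStabilizer M K″ →
    ∀ {a} → a ∈ K″ → Algebraic M K a
  setwise⇒algebraic em α {K} {K′} {K″} αK≤K′ α⁻¹K′≤K″ {a} a∈K″ =
    cover⇒finite em cover λ { (g , gK , refl) → covered g gK }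
    where
    module α = IsGroupIsomorphism (proj₂ α)
    f  = apply (Aut M) α
    f⁻ = unapply (Aut M) α

    -- For a tuple that is no image of K′ the default `G.ε` is harmless: it only enlarges the cover.
    rep : ∀ ys → ∃ λ r → ∀ h → List.map (to h) K′ ≡ ys → List.map (to r) K′ ≡ ys
    rep ys with em {∃ λ h → List.map (to h) K′ ≡ ys}
    ... | yes (r , eq) = r , λ _ _ → eq
    ... | no  ¬∃       = G.ε , λ h eq → contradiction (h , eq) ¬∃

    cover : List C
    cover = List.concatMap (λ ys → List.map (to (f⁻ (proj₁ (rep ys)))) K″)
              (tuples K′ (List.length K′))

    covered : ∀ g → Stab K g → to g a ∈ cover
    covered g gK = ∈-concatMap⁺ _ (lose
      (map-∈-tuples K′ λ {x} x∈K′ → Equivalence.to (αK≤K′ {g} gK x) x∈K′)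
      -- Here g a = u(u⁻¹g a), and u⁻¹g lies in α⁻¹(G₍K′₎), hence preserves K″.
      (subst (_∈ List.map (to u) K″) (strictlyInverseˡ u (to g a))
        (∈-map⁺ (to u) (Equivalence.to (α⁻¹K′≤K″ {u G.⁻¹ G.∙ g} fixK′ a) a∈K″))))
      where
      r = proj₁ (rep (List.map (to (f g)) K′))
      u = f⁻ r
      fixK′ : Stab K′ (f (u G.⁻¹ G.∙ g))
      fixK′ {x} x∈K′ = begin
        to (f (u G.⁻¹ G.∙ g)) x       ≡⟨ α.∙-homo (u G.⁻¹) g x ⟩
        to (f (u G.⁻¹)) (to (f g) x)  ≡⟨ α.⁻¹-homo u _ ⟩
        from (f u) (to (f g) x)
          ≡⟨ G.⁻¹-cong {f u} {r} (apply-unapply (Aut M) α r) _ ⟩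
        from r (to (f g) x)
          ≡⟨ cong (from r) (map-cong-∈⁻ K′ (proj₂ (rep _) (f g) refl) x∈K′) ⟨
        from r (to r x)               ≡⟨ strictlyInverseʳ r x ⟩
        x                             ∎
        where open ≡-Reasoning

  -- Conjugation by automorphisms of the orbital structure

  -- This is the closedness of G in Sym(M). Each preservation condition involves finitely many
  -- points: for a function symbol, the arguments together with the value.
  locally-automorphic : (b : C ↔ C) →
    (∀ {k} (xs : Vec C k) → ∃ λ (g : Iso M M) →
      Vec.map (to g) xs ≡ Vec.map (Inverse.to b) xs) →
    Iso M M
  locally-automorphic b agree = record
    { bij      = b
    ; fun-homo = λ f xs →
        let g , eq = agree (fun M f xs ∷ xs)
        in trans (sym (cong Vec.head eq))
             (trans (Iso.fun-homo g f xs) (cong (fun M f ∘ Vec.tail) eq))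
    ; rel-homo = λ r xs →
        let g , eq = agree xs
        in subst (λ ys → rel M r xs ⇔ rel M r ys) eq (Iso.rel-homo g r xs)
    }

  take-drop-++ : ∀ {n m} (xs : Vec C n) (ys : Vec C m) →
                 take n (xs ++ ys) ≡ xs × drop n (xs ++ ys) ≡ ys
  take-drop-++ {n} xs ys = ++-injective _ xs (take++drop≡id n (xs ++ ys))

  𝓔-preserves-orbits : (σ : Iso (𝓔 M) (𝓔 M)) → ∀ {n} (xs : Vec C n) (g : Iso M M) →
    ∃ λ (h : Iso M M) →
      Vec.map (to h) (Vec.map (to σ) xs) ≡ Vec.map (to σ) (Vec.map (to g) xs)
  -- Handled apart, since the orbital language has relations only for n > 0.
  𝓔-preserves-orbits σ {zero}  []         g = G.ε , refl
  𝓔-preserves-orbits σ {suc n} xs g =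
    let ys = Vec.map (to g) xs
        take≡ , drop≡ = take-drop-++ xs ys
        h , eq = Equivalence.to (Iso.rel-homo σ (suc n , _) (xs ++ ys))
                   (g , trans (cong (Vec.map (to g)) take≡) (sym drop≡))
    in h , (begin
      Vec.map (to h) (Vec.map (to σ) xs)
        ≡⟨ cong (Vec.map (to h) ∘ Vec.map (to σ)) take≡ ⟨
      Vec.map (to h) (Vec.map (to σ) (take (suc n) (xs ++ ys)))
        ≡⟨ cong (Vec.map (to h)) (take-map (to σ) (suc n) (xs ++ ys)) ⟨
      Vec.map (to h) (take (suc n) (Vec.map (to σ) (xs ++ ys)))  ≡⟨ eq ⟩
      drop (suc n) (Vec.map (to σ) (xs ++ ys))
        ≡⟨ drop-map (to σ) (suc n) (xs ++ ys) ⟩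
      Vec.map (to σ) (drop (suc n) (xs ++ ys))
        ≡⟨ cong (Vec.map (to σ)) drop≡ ⟩
      Vec.map (to σ) ys ∎)
    where open ≡-Reasoning

  -- The underlying bijection is σ g σ⁻¹ on the nose. On each tuple xs it agrees with an
  -- automorphism, because σ preserves the orbit relation between σ⁻¹(xs) and g(σ⁻¹(xs)).
  conjugate : Iso (𝓔 M) (𝓔 M) → Iso M M → Iso M M
  conjugate σ g = locally-automorphic (Iso.bij σ ↔-∘ (Iso.bij g ↔-∘ ↔-sym (Iso.bij σ))) λ xs →
    let xs′ = Vec.map (from σ) xs
        h , eq = 𝓔-preserves-orbits σ xs′ g
    in h , (begin
      Vec.map (to h) xs
        ≡⟨ cong (Vec.map (to h)) (trans (map-cong (strictlyInverseˡ σ) xs) (map-id xs)) ⟨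
      Vec.map (to h) (Vec.map (to σ ∘ from σ) xs)
        ≡⟨ cong (Vec.map (to h)) (map-∘ (to σ) (from σ) xs) ⟩
      Vec.map (to h) (Vec.map (to σ) xs′)  ≡⟨ eq ⟩
      Vec.map (to σ) (Vec.map (to g) xs′)  ≡⟨ map-∘ (to σ) (to g) xs′ ⟨
      Vec.map (to σ ∘ to g) xs′            ≡⟨ map-∘ (to σ ∘ to g) (from σ) xs ⟨
      Vec.map (to σ ∘ to g ∘ from σ) xs    ∎)
    where open ≡-Reasoning

  conjugation : Iso (𝓔 M) (𝓔 M) → Aut M ≅ᴳ Aut M
  conjugation σ = conjugate σ , record
    { isGroupMonomorphism = record
      { isGroupHomomorphism = record
        { isMonoidHomomorphism = record
          { isMagmaHomomorphism = record
            { isRelHomomorphism = record { cong = λ g≈h x → cong (to σ) (g≈h (from σ x)) }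
            ; homo = λ g h x →
                cong (to σ ∘ to g) (sym (strictlyInverseʳ σ (to h (from σ x))))
            }
          ; ε-homo = strictlyInverseˡ σ
          }
        ; ⁻¹-homo = λ g x → refl
        }
      ; injective = λ {g} {h} eq x → begin
          to g x                  ≡⟨ cong (to g) (strictlyInverseʳ σ x) ⟨
          to g (from σ (to σ x))  ≡⟨ ↔-injective (Iso.bij σ) (eq (to σ x)) ⟩
          to h (from σ (to σ x))  ≡⟨ cong (to h) (strictlyInverseʳ σ x) ⟩
          to h x                  ∎
      }
    ; surjective = λ g → conjugate (σ E.⁻¹) g , λ {h} h≈ x → begin
        to σ (to h (from σ x))
          ≡⟨ cong (to σ) (h≈ (from σ x)) ⟩
        to σ (from σ (to g (to σ (from σ x))))
          ≡⟨ strictlyInverseˡ σ _ ⟩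
        to g (to σ (from σ x))
          ≡⟨ cong (to g) (strictlyInverseˡ σ x) ⟩
        to g x ∎
    }
    where
    open ≡-Reasoning

  conjugation-continuous : ∀ σ → Continuous M (conjugate σ)
  conjugation-continuous σ = continuousAt-ε⇒continuous (conjugation σ) λ A →
    List.map (from σ) A , λ hA {x} x∈A →
      trans (cong (to σ) (hA (∈-map⁺ (from σ) x∈A))) (strictlyInverseˡ σ x)

  conjugationᵀ : Iso (𝓔 M) (𝓔 M) → TopAut M
  conjugationᵀ σ = record
    { aut       = conjugation σ
    ; to-cont   = conjugation-continuous σ
    -- `unapply` of `conjugation σ` is by definition conjugation by σ⁻¹.
    ; from-cont = conjugation-continuous (σ E.⁻¹)
    }

  -- From unique intertwiners to the isomorphism of groups.

  Intertwines : TopAut M → (C → C) → Set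
  Intertwines α s = ∀ g x → to (apply (Aut M) (aut α) g) (s x) ≡ s (to g x)

  module _ (φ : TopAut M → Iso (𝓔 M) (𝓔 M))
           (intertwines : ∀ α → Intertwines α (to (φ α)))
           (unique : ∀ α {s : C → C} → Intertwines α s → ∀ x → to (φ α) x ≡ s x) where

    φ-injective : ∀ α β → (∀ x → to (φ α) x ≡ to (φ β) x) →
      ∀ g x → to (apply (Aut M) (aut α) g) x ≡ to (apply (Aut M) (aut β) g) x
    φ-injective α β eq g x = begin
      to (f g) x            ≡⟨ cong (to (f g)) (strictlyInverseˡ σ x) ⟨
      to (f g) (to σ y)     ≡⟨ intertwines α g y ⟩
      to σ (to g y)         ≡⟨ eq _ ⟩
      to τ (to g y)         ≡⟨ intertwines β g y ⟨
      to (f′ g) (to τ y)    ≡⟨ cong (to (f′ g)) (eq y) ⟨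
      to (f′ g) (to σ y)    ≡⟨ cong (to (f′ g)) (strictlyInverseˡ σ x) ⟩
      to (f′ g) x           ∎
      where
      open ≡-Reasoning
      f  = apply (Aut M) (aut α)
      f′ = apply (Aut M) (aut β)
      σ  = φ α
      τ  = φ β
      y  = from σ x

    -- The homomorphism laws are instances of uniqueness: composites and inverses of intertwiners
    -- intertwine again. As `Intertwines` takes a bare function, these need no bundling as
    -- automorphisms of the orbital structure.
    intertwiners⇒AutTop≅Aut𝓔 : AutTop M ≅ᴳ Aut (𝓔 M)
    intertwiners⇒AutTop≅Aut𝓔 = φ , record
      { isGroupMonomorphism = record
        { isGroupHomomorphism = record
          { isMonoidHomomorphism = record
            { isMagmaHomomorphism = record
              { isRelHomomorphism = record
                { cong = λ {α} {β} α≈β → unique α λ g x →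
                    trans (α≈β g _) (intertwines β g x) }
              ; homo = λ α β → unique (α T.∙ β) λ g x →
                  trans (intertwines α (apply (Aut M) (aut β) g) _)
                    (cong (to (φ α)) (intertwines β g x))
              }
            ; ε-homo = unique T.ε λ g x → refl
            }
          ; ⁻¹-homo = λ α → unique (α T.⁻¹) λ g x → inverse-intertwines α g x
          }
        ; injective = λ {α} {β} → φ-injective α β
        }
      -- By construction σ intertwines conjugation by σ, so uniqueness returns σ.
      ; surjective = λ σ → conjugationᵀ σ , λ {α} α≈ → unique α λ g x →
          trans (α≈ g _) (cong (to σ ∘ to g) (strictlyInverseʳ σ x))
      }
      where
      inverse-intertwines : ∀ α → Intertwines (α T.⁻¹) (from (φ α))
      inverse-intertwines α g x = begin
        to k (from σ x)                         ≡⟨ strictlyInverseʳ σ _ ⟨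
        from σ (to σ (to k (from σ x)))
          ≡⟨ cong (from σ) (intertwines α k _) ⟨
        from σ (to (apply (Aut M) (aut α) k) (to σ (from σ x)))
          ≡⟨ cong (from σ) (apply-unapply (Aut M) (aut α) g _) ⟩
        from σ (to g (to σ (from σ x)))
          ≡⟨ cong (from σ ∘ to g) (strictlyInverseˡ σ x) ⟩
        from σ (to g x)                         ∎
        where
        open ≡-Reasoning
        σ = φ α
        k = unapply (Aut M) (aut α) g

  -- Topological automorphisms permute the point stabilizers.

  module _ (em : ExcludedMiddle 0ℓ) (wei : WeakEliminationOfImaginaries M)
           (na : NoAlgebraicity M) where

    -- Weak elimination only bounds α(G₍K₎) above by a setwise stabilizer. The pointwise bound comes
    -- from K″ ⊆ K, which gives G₍K₎ ≤ G₍K″₎ ≤ α⁻¹(G₍K′₎).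
    image-stabilizer : (α : TopAut M) → ∀ K → ∃ λ K′ →
      ∀ g → Stab K g ⇔ Stab K′ (apply (Aut M) (aut α) g)
    image-stabilizer α K = K′ , λ g →
      mk⇔ {A = Stab K g} {B = Stab K′ (f g)} (K⇒K′ g) (K′⇒K g)
      where
      f  = apply (Aut M) (aut α)
      f⁻ = unapply (Aut M) (aut α)

      -- As a preimage under α⁻¹ this is α(G₍K₎).
      H = preimage (aut (α T.⁻¹)) (stabilizer K)

      H-supported : ∃ (Supports M H)
      H-supported =
        let K₁ , supports , _ = wei H
              (continuous⇒continuousAt-ε (aut (α T.⁻¹)) (from-cont α) K)
        in K₁ , supports

      K′ = proj₁ H-supported

      K′≤H : Stab K′ ⊆ Subgroup.Member H
      K′≤H {g} = proj₁ (proj₂ (proj₂ H-supported)) {g}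

      H≤K′ : Subgroup.Member H ⊆ SetwiseStabilizer M K′
      H≤K′ {g} = proj₂ (proj₂ (proj₂ H-supported)) {g}

      H′ = preimage (aut α) (stabilizer K′)

      H′-supported : ∃ (Supports M H′)
      H′-supported =
        let K₂ , supports , _ = wei H′
              (continuous⇒continuousAt-ε (aut α) (to-cont α) K′)
        in K₂ , supports

      K″ = proj₁ H′-supported

      K″≤H′ : Stab K″ ⊆ Subgroup.Member H′
      K″≤H′ {g} = proj₁ (proj₂ (proj₂ H′-supported)) {g}

      H′≤K″ : Subgroup.Member H′ ⊆ SetwiseStabilizer M K″
      H′≤K″ {g} = proj₂ (proj₂ (proj₂ H′-supported)) {g}

      K⇒H : ∀ g → Stab K g → Subgroup.Member H (f g)
      K⇒H g = Subgroup.resp (stabilizer K) {g} {f⁻ (f g)}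
                (G.sym {f⁻ (f g)} {g} (unapply-apply (Aut M) (aut α) g))

      K″⊆K : (_∈ K″) ⊆ (_∈ K)
      K″⊆K = na K ∘ setwise⇒algebraic em (aut α) {K} {K′} {K″}
        (λ {g} gK → H≤K′ {f g} (K⇒H g λ {x} → gK {x})) (λ {g} → H′≤K″ {g})

      K⇒K′ : ∀ g → Stab K g → Stab K′ (f g)
      K⇒K′ g gK = K″≤H′ {g} λ x∈K″ → gK (K″⊆K x∈K″)

      K′⇒K : ∀ g → Stab K′ (f g) → Stab K g
      K′⇒K g fgK′ = Subgroup.resp (stabilizer K) {f⁻ (f g)} {g}
        (unapply-apply (Aut M) (aut α) g) (K′≤H {f g} λ {x} → fgK′ {x})

    SameStabilizer : TopAut M → C → C → Set
    SameStabilizer α a b =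
      ∀ g → to g a ≡ a ⇔ to (apply (Aut M) (aut α) g) b ≡ b

    -- Any entry b of the list for a satisfies α(G_a) ≤ G_b, and likewise α⁻¹(G_b) ≤ G_c. Hence G_a
    -- ≤ G_c, so c = a and both inclusions are equalities.
    image-point : (α : TopAut M) → ∀ a → ∃ (SameStabilizer α a)
    image-point α a with image-stabilizer α (a ∷ [])
    -- An empty list would make all of G fix a, putting a into the algebraically closed empty set.
    ... | [] , K⇔ = contradiction
          (fixed⇒∈ na {[]} {a} λ g _ → Equivalence.from (K⇔ g) (λ ()) (here refl)) λ ()
    ... | b ∷ K , K⇔ with image-stabilizer (α T.⁻¹) (b ∷ [])
    ...   | [] , K₂⇔ = contradiction
            (fixed⇒∈ na {[]} {b} λ g _ → Equivalence.from (K₂⇔ g) (λ ()) (here refl)) λ ()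
    ...   | c ∷ K₂ , K₂⇔ = b , λ g → mk⇔ (fixa⇒fixb g) (fixb⇒fixa g)
      where
      f  = apply (Aut M) (aut α)
      f⁻ = unapply (Aut M) (aut α)

      fixa⇒fixb : ∀ g → to g a ≡ a → to (f g) b ≡ b
      fixa⇒fixb g ga = Equivalence.to (K⇔ g) (λ { (here refl) → ga }) (here refl)

      fixb⇒fixc : ∀ g → to (f g) b ≡ b → to g c ≡ c
      fixb⇒fixc g fgb = trans (sym (unapply-apply (Aut M) (aut α) g c))
        (Equivalence.to (K₂⇔ (f g)) (λ { (here refl) → fgb }) (here refl))

      c≡a : c ≡ a
      c≡a = fixes-fixed⇒≡ na λ g ga → fixb⇒fixc g (fixa⇒fixb g ga)

      fixb⇒fixa : ∀ g → to (f g) b ≡ b → to g a ≡ a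
      fixb⇒fixa g fgb = subst (λ x → to g x ≡ x) c≡a (fixb⇒fixc g fgb)

    image-point-inverse : (α : TopAut M) → ∀ {a b c} →
      SameStabilizer α a b → SameStabilizer (α T.⁻¹) b c → c ≡ a
    image-point-inverse α a~b b~c = fixes-fixed⇒≡ na λ g ga →
      trans (sym (unapply-apply (Aut M) (aut α) g _))
        (Equivalence.to (b~c (apply (Aut M) (aut α) g)) (Equivalence.to (a~b g) ga))

    -- The permutation of M induced by a topological automorphism

    point-bijection : TopAut M → C ↔ C
    point-bijection α = mk↔ₛ′
      (λ a → proj₁ (image-point α a))
      (λ b → proj₁ (image-point (α T.⁻¹) b))
      -- This typechecks because `apply` of the double inverse of α reduces to `apply` of α.
      (λ b → image-point-inverse (α T.⁻¹) (proj₂ (image-point (α T.⁻¹) b))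
               (proj₂ (image-point α _)))
      (λ a → image-point-inverse α (proj₂ (image-point α a))
               (proj₂ (image-point (α T.⁻¹) _)))

    -- Stabilizers are compared. If h = α(k) fixes s(gx), then k fixes gx, so g⁻¹kg fixes x and its
    -- image under α fixes s(x); thus h fixes α(g)(s(x)).
    point-bijection-intertwines : ∀ α → Intertwines α (Inverse.to (point-bijection α))
    point-bijection-intertwines α g x = fixes-fixed⇒≡ na λ h h-fixes →
      let k = f⁻ h
          fk≈h = apply-unapply (Aut M) (aut α) h
          k-fixes : to k (to g x) ≡ to g x
          k-fixes = Equivalence.from (proj₂ (image-point α (to g x)) k)
                      (trans (fk≈h _) h-fixes)
          gkg-fixes : from g (to k (to g x)) ≡ x
          gkg-fixes = trans (cong (from g) k-fixes) (strictlyInverseʳ g x)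
          σgkg-fixes : to (f (g G.⁻¹ G.∙ (k G.∙ g))) (s x) ≡ s x
          σgkg-fixes = Equivalence.to (proj₂ (image-point α x) (g G.⁻¹ G.∙ (k G.∙ g))) gkg-fixes
      in begin
        to h (to (f g) (s x))       ≡⟨ fk≈h _ ⟨
        to (f k) (to (f g) (s x))   ≡⟨ α.∙-homo k g (s x) ⟨
        to (f (k G.∙ g)) (s x)      ≡⟨ strictlyInverseˡ (f g) _ ⟨
        to (f g) (from (f g) (to (f (k G.∙ g)) (s x)))
          ≡⟨ cong (to (f g)) (α.⁻¹-homo g _) ⟨
        to (f g) (to (f (g G.⁻¹)) (to (f (k G.∙ g)) (s x)))
          ≡⟨ cong (to (f g)) (α.∙-homo (g G.⁻¹) (k G.∙ g) (s x)) ⟨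
        to (f g) (to (f (g G.⁻¹ G.∙ (k G.∙ g))) (s x))
          ≡⟨ cong (to (f g)) σgkg-fixes ⟩
        to (f g) (s x)              ∎
      where
      open ≡-Reasoning
      module α = IsGroupIsomorphism (proj₂ (aut α))
      f  = apply (Aut M) (aut α)
      f⁻ = unapply (Aut M) (aut α)
      s  = Inverse.to (point-bijection α)

    -- If g witnesses an orbit relation, α(g) witnesses its image under b; backwards, α⁻¹(h) serves
    -- for h.
    intertwiner-𝓔 : ∀ α (b : C ↔ C) → Intertwines α (Inverse.to b) → Iso (𝓔 M) (𝓔 M)
    intertwiner-𝓔 α b b-int = record
      { bij      = b
      ; fun-homo = λ ()
      ; rel-homo = λ (n , _) v → mk⇔
          (λ (g , eq) → f g , (begin
            Vec.map (to (f g)) (take n (Vec.map s v))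
              ≡⟨ along g v ⟩
            Vec.map s (Vec.map (to g) (take n v))
              ≡⟨ cong (Vec.map s) eq ⟩
            Vec.map s (drop n v)
              ≡⟨ drop-map s n v ⟨
            drop n (Vec.map s v) ∎))
          (λ (h , eq) → f⁻ h , Vec-map-injective (↔-injective b) (begin
            Vec.map s (Vec.map (to (f⁻ h)) (take n v))
              ≡⟨ along (f⁻ h) v ⟨
            Vec.map (to (f (f⁻ h))) (take n (Vec.map s v))
              ≡⟨ map-cong (apply-unapply (Aut M) (aut α) h) _ ⟩
            Vec.map (to h) (take n (Vec.map s v))
              ≡⟨ eq ⟩
            drop n (Vec.map s v)
              ≡⟨ drop-map s n v ⟩
            Vec.map s (drop n v) ∎))
      }
      where
      open ≡-Reasoning
      f  = apply (Aut M) (aut α)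
      f⁻ = unapply (Aut M) (aut α)
      s  = Inverse.to b

      along : ∀ g {n m} (v : Vec C (n + m)) →
        Vec.map (to (f g)) (take n (Vec.map s v)) ≡ Vec.map s (Vec.map (to g) (take n v))
      along g {n} v = begin
        Vec.map (to (f g)) (take n (Vec.map s v))    ≡⟨ cong (Vec.map _) (take-map s n v) ⟩
        Vec.map (to (f g)) (Vec.map s (take n v))    ≡⟨ map-∘ (to (f g)) s _ ⟨
        Vec.map (to (f g) ∘ s) (take n v)
          ≡⟨ map-cong (b-int g) _ ⟩
        Vec.map (s ∘ to g) (take n v)                ≡⟨ map-∘ s (to g) _ ⟩
        Vec.map s (Vec.map (to g) (take n v))        ∎

    induced : TopAut M → Iso (𝓔 M) (𝓔 M)
    induced α = intertwiner-𝓔 α (point-bijection α) (point-bijection-intertwines α)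

    -- With σ the induced permutation, if h = α(k) fixes σ(x), then k fixes x by injectivity of σ,
    -- so h fixes s(x).
    induced-unique : ∀ α {s : C → C} → Intertwines α s → ∀ x → to (induced α) x ≡ s x
    induced-unique α {s} s-int x = sym (fixes-fixed⇒≡ na λ h h-fixes →
      let k = f⁻ h
          fk≈h = apply-unapply (Aut M) (aut α) h
          k-fixes : to k x ≡ x
          k-fixes = ↔-injective (Iso.bij (induced α))
            (trans (sym (point-bijection-intertwines α k x)) (trans (fk≈h _) h-fixes))
      in trans (sym (fk≈h (s x))) (trans (s-int k x) (cong s k-fixes)))
      where f⁻ = unapply (Aut M) (aut α)

    AutTop≅Aut𝓔 : AutTop M ≅ᴳ Aut (𝓔 M)
    AutTop≅Aut𝓔 = intertwiners⇒AutTop≅Aut𝓔 induced point-bijection-intertwines induced-unique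

  -- The small index case and the conclusion.

  AutGroup≅AutTop : (∀ α → Continuous M (apply (Aut M) α)) → AutGroup (Aut M) ≅ᴳ AutTop M
  AutGroup≅AutTop continuous =
    (λ α → record { aut = α ; to-cont = continuous α ; from-cont = continuous (invᴳ (Aut M) α) })
    , record
      { isGroupMonomorphism = record
        { isGroupHomomorphism = record
          { isMonoidHomomorphism = record
            { isMagmaHomomorphism = record
              { isRelHomomorphism = record { cong = id }
              ; homo = λ α β g x → refl
              }
            ; ε-homo = λ g x → refl
            }
          ; ⁻¹-homo = λ α g x → refl
          }
        ; injective = id
        }
      ; surjective = λ α → aut α , id
      }

theorem1p4 : (∀ ℓ → ExcludedMiddle ℓ) →
    (L : Language) (M : Structure L) →
    Countable M →
    ωCategorical M →
    Homogeneous M →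
    WeakEliminationOfImaginaries M →
    NoAlgebraicity M →
    (AutTop M ≅ᴳ Aut (𝓔 M)) ×
    (SmallIndexProperty M → AutGroup (Aut M) ≅ᴳ Aut (𝓔 M))
theorem1p4 em L M ι _ _ wei na =
    AutTop≅Aut𝓔 M (em 0ℓ) wei na
  , λ sip → ≅ᴳ-trans {G = AutGroup (Aut M)} {AutTop M} {Aut (𝓔 M)}
      (AutGroup≅AutTop M (smallIndex⇒continuous M (em 0ℓ) ι sip))
      (AutTop≅Aut𝓔 M (em 0ℓ) wei na)
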